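{- Let $n,k$ be integers with $n\ge 2k\ge 4$ and let $Y$ be a graph on $n$ vertices. If $Y$ is disconnected, or $Y$ is bipartite, or $Y$ contains a non-trivial $k$-bridge, or $Y$ is (isomorphic to) the cycle $C_n$, then the friends-and-strangers graph $\mathsf{FS}(K_{k,n-k},Y)$ is disconnected.
   Context: All graphs are finite and simple, without loops. $C_n$ is the cycle on $n$ vertices and $K_{k,n-k}$ is the complete bipartite graph with parts of sizes $k$ and $n-k$. Friends-and-strangers graph: for graphs $X,Y$ each with $n$ vertices, $\mathsf{FS}(X,Y)$ is the graph whose vertices are all bijections $\sigma:V(X)\to V(Y)$; two bijections $\sigma,\sigma'$ are adjacent if and only if there is an edge $ab\in E(X)$ such that $\sigma(a)\sigma(b)\in E(Y)$, $\sigma(a)=\sigma'(b)$, $\sigma(b)=\sigma'(a)$, and $\sigma(c)=\sigma'(c)$ for all $c\in V(X)\setminus\{a,b\}$. Non-trivial $k$-bridge ($k\ge 2$): a cut edge of a connected graph is an edge whose removal disconnects the graph; it is non-trivial if neither of its ends has degree one. If a path $P=v_1v_2\cdots v_k$ is obtained by subdividing $k-2$ times a non-trivial cut edge $v_1v_k$ of a connected graph, then $P$ is called a non-trivial $k$-bridge of the resulting graph. That is, a graph $Y$ contains a non-trivial $k$-bridge if $Y$ is obtained from some connected graph $H$ with a non-trivial cut edge $v_1v_k$ by replacing this edge with a path $v_1v_2\cdots v_k$ whose interior vertices $v_2,\dots,v_{k-1}$ are new vertices (having degree 2 in $Y$). A non-trivial $2$-bridge is just a non-trivial cut edge. -}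

module Defs where

open import Data.Bool.Base using (Bool)
open import Data.Fin.Base using (Fin; toℕ)
open import Data.Fin.Permutation using (Permutation; _⟨$⟩ʳ_) renaming (_≈_ to _≈ₚ_)
open import Data.Fin.Properties using (_≟_; any?; all?)
open import Data.List.Base using (length; filter; allFin)
open import Data.Nat.Base using (ℕ; suc; _+_; _∸_; _≤_; _<_)
import Data.Nat.Properties as ℕ
open import Data.Product.Base using (∃; ∃-syntax; _×_; _,_)
open import Data.Sum.Base using (_⊎_; inj₁; inj₂)
open import Data.Empty using (⊥)
open import Function.Base using (_∘_)
open import Function.Bundles using (Inverse; _⇔_)
open import Level using (0ℓ)
open import Relation.Binary.Bundles using (Setoid)
open import Relation.Binary.Core using (Rel)
open import Relation.Binary.Definitions using (Decidable; Irreflexive; Symmetric; _Respects₂_)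
open import Relation.Binary.Construct.Closure.ReflexiveTransitive using (Star)
open import Relation.Binary.PropositionalEquality
  using (_≡_; _≢_; refl; sym; trans; subst₂; setoid; resp₂)
open import Relation.Nullary using (¬_; no)
open import Relation.Nullary.Decidable using (_×-dec_; _⊎-dec_; _→-dec_; ¬?)

-- The vertices form a setoid because the vertices of a friends-and-strangers
-- graph are bijections, which are compared pointwise.
record Graph (V : Setoid 0ℓ 0ℓ) : Set₁ where
  open Setoid V using (_≈_) renaming (Carrier to Vertex)
  infix 4 _~_ _~?_
  field
    _~_      : Rel Vertex 0ℓ
    _~?_     : Decidable _~_
    ~-sym    : Symmetric _~_
    ~-irrefl : Irreflexive _≈_ _~_
    ~-resp   : _~_ Respects₂ _≈_

FinGraph : ℕ → Set₁
FinGraph n = Graph (setoid (Fin n))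

module _ {V : Setoid 0ℓ 0ℓ} (G : Graph V) where
  open Setoid V using (_≈_) renaming (Carrier to Vertex)
  open Graph G

  Reachable : Rel Vertex 0ℓ
  Reachable x y = ∃[ z ] Star _~_ x z × z ≈ y

  Connected : Set
  Connected = ∀ x y → Reachable x y

  Disconnected : Set
  Disconnected = ¬ Connected

  Bipartite : Set
  Bipartite = ∃ λ (colour : Vertex → Bool) →
    (∀ {x y} → x ≈ y → colour x ≡ colour y) ×
    (∀ {x y} → x ~ y → colour x ≢ colour y)

infix 4 _≅_

_≅_ : {V W : Setoid 0ℓ 0ℓ} → Graph V → Graph W → Set
_≅_ {V} {W} G H =
  ∃ λ (f : Inverse V W) →
    ∀ x y → (x G.~ y) ⇔ (Inverse.to f x H.~ Inverse.to f y)
  where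
  module G = Graph G
  module H = Graph H

degree : ∀ {n} → FinGraph n → Fin n → ℕ
degree {n} G x = length (filter (x ~?_) (allFin n))
  where open Graph G

-- K p q: the parts are the first p and the last q vertices.
K : ∀ p q → FinGraph (p + q)
K p q = record
  { _~_      = λ x y → (toℕ x < p × p ≤ toℕ y) ⊎ (p ≤ toℕ x × toℕ y < p)
  ; _~?_     = λ x y → (toℕ x ℕ.<? p ×-dec p ℕ.≤? toℕ y)
                       ⊎-dec (p ℕ.≤? toℕ x ×-dec toℕ y ℕ.<? p)
  ; ~-sym    = λ { (inj₁ (l , r)) → inj₂ (r , l) ; (inj₂ (l , r)) → inj₁ (r , l) }
  ; ~-irrefl = λ { refl (inj₁ (l , r)) → ℕ.<⇒≱ l r ; refl (inj₂ (l , r)) → ℕ.<⇒≱ r l }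
  ; ~-resp   = resp₂ _
  }

-- For n ≥ 3 the condition x ≢ y is automatic; it only keeps C 1 loopless.
C : ∀ n → FinGraph n
C n = record
  { _~_      = λ x y → x ≢ y × (Next x y ⊎ Next y x)
  ; _~?_     = λ x y → ¬? (x ≟ y) ×-dec (next? x y ⊎-dec next? y x)
  ; ~-sym    = λ { (x≢y , inj₁ p) → x≢y ∘ sym , inj₂ p
                 ; (x≢y , inj₂ p) → x≢y ∘ sym , inj₁ p }
  ; ~-irrefl = λ x≡y (x≢y , _) → x≢y x≡y
  ; ~-resp   = resp₂ _
  }
  where
  Next : Rel (Fin n) 0ℓ
  Next x y = suc (toℕ x) ≡ toℕ y ⊎ (suc (toℕ x) ≡ n × toℕ y ≡ 0)

  next? : Decidable Next
  next? x y = (suc (toℕ x) ℕ.≟ toℕ y) ⊎-dec ((suc (toℕ x) ℕ.≟ n) ×-dec (toℕ y ℕ.≟ 0))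

Bijections : ℕ → ℕ → Setoid 0ℓ 0ℓ
Bijections m n = record
  { Carrier       = Permutation m n
  ; _≈_           = _≈ₚ_
  ; isEquivalence = record
    { refl  = λ _ → refl
    ; sym   = λ σ≈τ i → sym (σ≈τ i)
    ; trans = λ σ≈τ τ≈υ i → trans (σ≈τ i) (τ≈υ i)
    }
  }

-- The two graphs may have differently written numbers of vertices, such as
-- k + (n ∸ k) and n; there are no bijections unless these numbers are equal.
FS : ∀ {m n} → FinGraph m → FinGraph n → Graph (Bijections m n)
FS {m} {n} X Y = record
  { _~_      = Swap
  ; _~?_     = λ σ σ′ → any? λ a → any? λ b →
      (a X.~? b) ×-dec (σ ⟨$⟩ʳ a Y.~? σ ⟨$⟩ʳ b) ×-dec
      (σ ⟨$⟩ʳ a ≟ σ′ ⟨$⟩ʳ b) ×-dec (σ ⟨$⟩ʳ b ≟ σ′ ⟨$⟩ʳ a) ×-dec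
      all? (λ c → ¬? (c ≟ a) →-dec (¬? (c ≟ b) →-dec (σ ⟨$⟩ʳ c ≟ σ′ ⟨$⟩ʳ c)))
  ; ~-sym    = λ (a , b , ab , σab , p , q , r) →
      a , b , ab , Y.~-sym (subst₂ Y._~_ p q σab) , sym q , sym p ,
      λ c c≢a c≢b → sym (r c c≢a c≢b)
  ; ~-irrefl = λ σ≈τ (a , b , ab , σab , p , q , r) →
      Y.~-irrefl (trans p (sym (σ≈τ b))) σab
  ; ~-resp   =
      (λ τ≈υ (a , b , ab , σab , p , q , r) →
         a , b , ab , σab , trans p (τ≈υ b) , trans q (τ≈υ a) ,
         λ c c≢a c≢b → trans (r c c≢a c≢b) (τ≈υ c)) ,
      (λ τ≈υ (a , b , ab , τab , p , q , r) →
         a , b , ab , subst₂ Y._~_ (τ≈υ a) (τ≈υ b) τab ,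
         trans (sym (τ≈υ a)) p , trans (sym (τ≈υ b)) q ,
         λ c c≢a c≢b → trans (sym (τ≈υ c)) (r c c≢a c≢b))
  }
  where
  module X = Graph X
  module Y = Graph Y

  Swap : Rel (Permutation m n) 0ℓ
  Swap σ σ′ = ∃[ a ] ∃[ b ]
    a X.~ b ×
    σ ⟨$⟩ʳ a Y.~ σ ⟨$⟩ʳ b ×
    σ ⟨$⟩ʳ a ≡ σ′ ⟨$⟩ʳ b ×
    σ ⟨$⟩ʳ b ≡ σ′ ⟨$⟩ʳ a ×
    (∀ c → c ≢ a → c ≢ b → σ ⟨$⟩ʳ c ≡ σ′ ⟨$⟩ʳ c)

removeEdge : ∀ {m} → FinGraph m → Fin m → Fin m → FinGraph m
removeEdge {m} H u v = record
  { _~_      = λ x y → x ~ y × ¬ IsUV x y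
  ; _~?_     = λ x y → (x ~? y) ×-dec
      ¬? (((x ≟ u) ×-dec (y ≟ v)) ⊎-dec ((x ≟ v) ×-dec (y ≟ u)))
  ; ~-sym    = λ (xy , ne) →
      ~-sym xy , λ { (inj₁ (p , q)) → ne (inj₂ (q , p))
                   ; (inj₂ (p , q)) → ne (inj₁ (q , p)) }
  ; ~-irrefl = λ x≡y (xy , _) → ~-irrefl x≡y xy
  ; ~-resp   = resp₂ _
  }
  where
  open Graph H
  IsUV : Rel (Fin m) 0ℓ
  IsUV x y = (x ≡ u × y ≡ v) ⊎ (x ≡ v × y ≡ u)

-- The edge uv is replaced by the path u, inj₂ 0, …, inj₂ (j ∸ 1), v;
-- for j = 0 this path is the edge uv itself.
subdivideEdge : ∀ {m} (H : FinGraph m) {u v} → Graph._~_ H u v →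
                (j : ℕ) → Graph (setoid (Fin m ⊎ Fin j))
subdivideEdge {m} H {u} {v} uv j = record
  { _~_      = λ x y → Old x y ⊎ Step x y ⊎ Step y x
  ; _~?_     = λ x y → old? x y ⊎-dec step? x y ⊎-dec step? y x
  ; ~-sym    = λ { {x} {y} (inj₁ p) → inj₁ (old-sym x y p)
                 ; (inj₂ (inj₁ p)) → inj₂ (inj₂ p)
                 ; (inj₂ (inj₂ p)) → inj₂ (inj₁ p) }
  ; ~-irrefl = λ { {x} refl (inj₁ p) → old-irrefl x p
                 ; {x} refl (inj₂ (inj₁ p)) → step-irrefl x p
                 ; {x} refl (inj₂ (inj₂ p)) → step-irrefl x p }
  ; ~-resp   = resp₂ _
  }
  where
  module H = Graph H
  module H-uv = Graph (removeEdge H u v)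

  Old Step : Rel (Fin m ⊎ Fin j) 0ℓ
  Old (inj₁ x) (inj₁ y) = x H-uv.~ y
  Old _        _        = ⊥

  Step (inj₁ x) (inj₁ y)  = j ≡ 0 × x ≡ u × y ≡ v
  Step (inj₁ x) (inj₂ i)  = x ≡ u × toℕ i ≡ 0
  Step (inj₂ i) (inj₂ i′) = suc (toℕ i) ≡ toℕ i′
  Step (inj₂ i) (inj₁ y)  = suc (toℕ i) ≡ j × y ≡ v

  old? : Decidable Old
  old? (inj₁ x) (inj₁ y) = x H-uv.~? y
  old? (inj₁ _) (inj₂ _) = no λ ()
  old? (inj₂ _) _        = no λ ()

  step? : Decidable Step
  step? (inj₁ x) (inj₁ y)  = (j ℕ.≟ 0) ×-dec (x ≟ u) ×-dec (y ≟ v)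
  step? (inj₁ x) (inj₂ i)  = (x ≟ u) ×-dec (toℕ i ℕ.≟ 0)
  step? (inj₂ i) (inj₂ i′) = suc (toℕ i) ℕ.≟ toℕ i′
  step? (inj₂ i) (inj₁ y)  = (suc (toℕ i) ℕ.≟ j) ×-dec (y ≟ v)

  old-sym : ∀ x y → Old x y → Old y x
  old-sym (inj₁ x) (inj₁ y) p = H-uv.~-sym p

  old-irrefl : ∀ x → ¬ Old x x
  old-irrefl (inj₁ x) p = H-uv.~-irrefl refl p

  step-irrefl : ∀ x → ¬ Step x x
  step-irrefl (inj₁ x) (_ , x≡u , x≡v) = H.~-irrefl (trans (sym x≡u) x≡v) uv
  step-irrefl (inj₂ i) p               = ℕ.1+n≢n p

record NonTrivialCutEdge {m} (H : FinGraph m) (u v : Fin m) : Set where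
  open Graph H
  field
    edge      : u ~ v
    cut       : Disconnected (removeEdge H u v)
    degree-u  : degree H u ≢ 1
    degree-v  : degree H v ≢ 1

-- Meaningful for k ≥ 2 only.
record NonTrivialBridge (k : ℕ) {n} (Y : FinGraph n) : Set₁ where
  field
    {m}         : ℕ
    H           : FinGraph m
    H-connected : Connected H
    {v₁ vₖ}     : Fin m
    cutEdge     : NonTrivialCutEdge H v₁ vₖ
    Y≅          : Y ≅ subdivideEdge H (NonTrivialCutEdge.edge cutEdge) (k ∸ 2)

{-# OPTIONS --safe #-}

-- View σ as a placement of tokens on the vertices of Y, the first k of them
-- black and the others white.  A move exchanges a black and a white token on
-- adjacent vertices, and each hypothesis on Y yields an invariant:
--   * disconnected: the component of every token;
--   * bipartite: the sign of σ plus the number of black tokens on one side,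
--     modulo 2, which exchanging two white tokens changes;
--   * bridge: number its vertices 1, …, k, with 0 before and k + 1 behind it.  A
--     white token starting at 0 is never higher than the number of black tokens
--     below it, so that it cannot reach k + 1;
--   * cycle: the cyclic order of three white tokens.  Only n = 4 lacks a third
--     white token, and C₄ is bipartite.
module Submission where

open import Defs
open import Data.Nat.Base using (ℕ; _*_; _∸_; _≥_)
open import Data.Sum.Base using (_⊎_)

open import Algebra.Bundles using (CommutativeRing)
open import Data.Bool.Base using (Bool; true; false; not; _∧_; _xor_; if_then_else_)
import Data.Bool.Properties as Bool
open import Data.Bool.Properties using
  (xor-∧-commutativeRing; xor-same; xor-comm; xor-assoc; xor-identityʳ; xor-annihilates-not;
   not-distribˡ-xor; not-distribʳ-xor; ∧-comm; not-¬; ¬-not)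
open import Data.Fin.Base using (Fin; zero; suc; toℕ; _↑ˡ_; _↑ʳ_; fromℕ<; reduce≥; punchIn)
open import Data.Fin.Patterns using (0F; 1F; 2F; 3F)
open import Data.Fin.Permutation using (Permutation; _⟨$⟩ʳ_; transpose; _∘ₚ_; cast-id)
import Data.Fin.Permutation.Components as PC
open import Data.Fin.Properties using
  (_≟_; any?; all?; sequence; toℕ-injective; toℕ<n; toℕ-↑ˡ; toℕ-↑ʳ; ↑ˡ-injective; ↑ʳ-injective;
   splitAt-<; splitAt-≥; splitAt⁻¹-↑ˡ; splitAt⁻¹-↑ʳ; toℕ-fromℕ<; fromℕ<-toℕ; punchInᵢ≢i)
open import Data.List.Base using ([]; _∷_; length; allFin)
open import Data.List.Membership.Propositional using (_∈_)
open import Data.List.Membership.Propositional.Properties using (∈-allFin; ∈-filter⁺; ∈-filter⁻)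
open import Data.List.Relation.Unary.All using (_∷_)
open import Data.List.Relation.Unary.AllPairs using (_∷_)
open import Data.List.Relation.Unary.Any using (here; there)
open import Data.List.Relation.Unary.Unique.Propositional using (Unique)
open import Data.List.Relation.Unary.Unique.Propositional.Properties using (allFin⁺; filter⁺)
open import Data.Nat.Base using (zero; suc; _+_; _≤_; _<_; _<ᵇ_; z≤n; s≤s; s≤s⁻¹)
import Data.Nat.Properties as ℕ
open import Data.Product.Base using (∃; _×_; _,_; proj₁; proj₂)
open import Data.Sum.Base using (inj₁; inj₂)
open import Effect.Monad using (RawMonad)
open import Function.Base using (_∘_; id)
open import Function.Bundles using (Inverse; Injection; Equivalence)
open import Function.Properties.Inverse using (↔⇒↣)
open import Level using (0ℓ)
open import Relation.Binary.Bundles using (Setoid)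
open import Relation.Binary.Construct.Closure.ReflexiveTransitive
  using (Star; ε; _◅_; _◅◅_; reverse)
open import Relation.Binary.Definitions using (Tri; tri<; tri≈; tri>)
open import Relation.Binary.PropositionalEquality using
  (_≡_; _≢_; _≗_; setoid; refl; sym; trans; cong; cong₂; subst; subst₂; module ≡-Reasoning)
open import Relation.Nullary using (¬_; Dec; yes; no; does; contradiction)
open import Relation.Nullary.Decidable using
  (dec-true; dec-false; _×-dec_; ¬?; _→-dec_; ¬¬-excluded-middle; from-yes; decidable-stable)
open import Relation.Nullary.Negation using (¬¬-Monad; ¬¬-map)

-- Invariants along paths, and transpositions

module _ {V : Setoid 0ℓ 0ℓ} (G : Graph V) where
  open Setoid V using (_≈_) renaming (Carrier to Vertex)
  open Graph G

  reachable-preserves : (P : Vertex → Set) → (∀ {x y} → x ≈ y → P x → P y) →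
    (∀ {x y} → x ~ y → P x → P y) → ∀ {x y} → Reachable G x y → P x → P y
  reachable-preserves P resp step (z , steps , z≈y) = resp z≈y ∘ along steps
    where
    along : ∀ {x z} → Star _~_ x z → P x → P z
    along ε        = id
    along (s ◅ ss) = along ss ∘ step s

module _ {n} (i j : Fin n) where
  transpose-left : PC.transpose i j i ≡ j
  transpose-left rewrite dec-true (i ≟ i) refl = refl

  transpose-right : PC.transpose i j j ≡ i
  transpose-right with j ≟ i
  ... | yes j≡i = j≡i
  ... | no  _ rewrite dec-true (j ≟ j) refl = refl

  transpose-other : ∀ {k} → k ≢ i → k ≢ j → PC.transpose i j k ≡ k
  transpose-other {k} k≢i k≢j
    rewrite dec-false (k ≟ i) k≢i | dec-false (k ≟ j) k≢j = refl

to-injective : ∀ {m n} (σ : Permutation m n) {x y} → σ ⟨$⟩ʳ x ≡ σ ⟨$⟩ʳ y → x ≡ y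
to-injective σ = Injection.injective (↔⇒↣ σ)

-- Supplies start and end configurations with a tracked token on a prescribed vertex: any bijection
-- will do, once a transposition of the target has corrected it.
placing : ∀ {m n} → m ≡ n → (a : Fin m) (x : Fin n) → ∃ λ (σ : Permutation m n) → σ ⟨$⟩ʳ a ≡ x
placing m≡n a x = σ ∘ₚ transpose (σ ⟨$⟩ʳ a) x , transpose-left (σ ⟨$⟩ʳ a) x
  where σ = cast-id m≡n

-- Sums modulo 2

module Xor where
  open CommutativeRing xor-∧-commutativeRing public using (+-commutativeMonoid)
  open import Algebra.Properties.CommutativeMonoid.Sum +-commutativeMonoid public

open Xor using (sum-cong-≗; sum-remove; sum-permute; ∑-distrib-+; sum-replicate-zero)

-- Both sides consist of the common terms off `i` together with the two values at `i`.
xor-sum-update : ∀ {n} (f g : Fin n → Bool) (i : Fin n) → (∀ j → j ≢ i → f j ≡ g j) →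
  Xor.sum f xor g i ≡ Xor.sum g xor f i
xor-sum-update {suc n} f g i f≗g = begin
  Xor.sum f xor g i
    ≡⟨ cong (_xor g i) (sum-remove {i = i} f) ⟩
  (f i xor Xor.sum (f ∘ punchIn i)) xor g i
    ≡⟨ cong (λ s → (f i xor s) xor g i) (sum-cong-≗ λ j → f≗g _ (punchInᵢ≢i i j)) ⟩
  (f i xor s) xor g i
    ≡⟨ rearrange (f i) s (g i) ⟩
  (g i xor s) xor f i
    ≡⟨ cong (_xor f i) (sum-remove {i = i} g) ⟨
  Xor.sum g xor f i ∎
  where
  open ≡-Reasoning
  s = Xor.sum (g ∘ punchIn i)
  rearrange : ∀ a b c → (a xor b) xor c ≡ (c xor b) xor a
  rearrange a b c = trans (xor-comm (a xor b) c)
    (trans (cong (c xor_) (xor-comm a b)) (sym (xor-assoc c b a)))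

xor-sum-single : ∀ {n} (f : Fin n → Bool) (i : Fin n) → (∀ j → j ≢ i → f j ≡ false) →
  Xor.sum f ≡ f i
xor-sum-single {n} f i f≗0 = begin
  Xor.sum f                         ≡⟨ xor-identityʳ _ ⟨
  Xor.sum f xor false               ≡⟨ xor-sum-update f (λ _ → false) i f≗0 ⟩
  Xor.sum {n} (λ _ → false) xor f i ≡⟨ cong (_xor f i) (sum-replicate-zero n) ⟩
  f i                               ∎
  where open ≡-Reasoning

-- The terms of `(x , y)` and `(y , x)` cancel. The induction splits off the first row and the first
-- column, which have the same sum `r`.
xor-double-sum-symmetric : ∀ {n} (f : Fin n → Fin n → Bool) → (∀ x → f x x ≡ false) →
  (∀ x y → f x y ≡ f y x) → Xor.sum (λ x → Xor.sum (f x)) ≡ false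
xor-double-sum-symmetric {zero}  f diag f-sym = refl
xor-double-sum-symmetric {suc n} f diag f-sym = begin
  (f zero zero xor r) xor Xor.sum (λ x → f (suc x) zero xor Xor.sum (f (suc x) ∘ suc))
    ≡⟨ cong₂ _xor_ (cong (_xor r) (diag zero)) (∑-distrib-+ (λ x → f (suc x) zero) _) ⟩
  r xor (Xor.sum (λ x → f (suc x) zero) xor Xor.sum (λ x → Xor.sum (f (suc x) ∘ suc)))
    ≡⟨ cong₂ (λ c s → r xor (c xor s)) (sum-cong-≗ λ x → f-sym (suc x) zero)
         (xor-double-sum-symmetric (λ x y → f (suc x) (suc y)) (diag ∘ suc)
           λ x y → f-sym (suc x) (suc y)) ⟩
  r xor (r xor false)  ≡⟨ cong (r xor_) (xor-identityʳ r) ⟩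
  r xor r              ≡⟨ xor-same r ⟩
  false                ∎
  where
  open ≡-Reasoning
  r = Xor.sum (λ y → f zero (suc y))

-- The sign of a permutation

<ᵇ-irrefl : ∀ n → (n <ᵇ n) ≡ false
<ᵇ-irrefl zero    = refl
<ᵇ-irrefl (suc n) = <ᵇ-irrefl n

<ᵇ-flip : ∀ {m n} → m ≢ n → (n <ᵇ m) ≡ not (m <ᵇ n)
<ᵇ-flip {zero}  {zero}  m≢n = contradiction refl m≢n
<ᵇ-flip {zero}  {suc n} m≢n = refl
<ᵇ-flip {suc m} {zero}  m≢n = refl
<ᵇ-flip {suc m} {suc n} m≢n = <ᵇ-flip (m≢n ∘ cong suc)

-- The parity of the number of pairs which the rankings r and s order
-- differently.
disagreement : ∀ {n} (r s : Fin n → ℕ) → Bool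
disagreement r s = Xor.sum λ x → Xor.sum λ y → (r x <ᵇ r y) ∧ (s y <ᵇ s x)

InjectiveRank : ∀ {n} → (Fin n → ℕ) → Set
InjectiveRank r = ∀ {x y} → r x ≡ r y → x ≡ y

xor-double-sum-cong : ∀ {n} {f g : Fin n → Fin n → Bool} → (∀ x y → f x y ≡ g x y) →
  Xor.sum (λ x → Xor.sum (f x)) ≡ Xor.sum (λ x → Xor.sum (g x))
xor-double-sum-cong eq = sum-cong-≗ λ x → sum-cong-≗ (eq x)

xor-double-sum-distrib : ∀ {n} (f g : Fin n → Fin n → Bool) →
  Xor.sum (λ x → Xor.sum λ y → f x y xor g x y) ≡
  Xor.sum (λ x → Xor.sum (f x)) xor Xor.sum (λ x → Xor.sum (g x))
xor-double-sum-distrib f g =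
  trans (sum-cong-≗ λ x → ∑-distrib-+ (f x) (g x))
        (∑-distrib-+ (Xor.sum ∘ f) (Xor.sum ∘ g))

disagreement-self : ∀ {n} (r : Fin n → ℕ) → disagreement r r ≡ false
disagreement-self r = xor-double-sum-symmetric _
  (λ x → cong (λ b → b ∧ b) (<ᵇ-irrefl (r x)))
  (λ x y → ∧-comm (r x <ᵇ r y) (r y <ᵇ r x))

xor≡false⇒≡ : ∀ {a b} → a xor b ≡ false → a ≡ b
xor≡false⇒≡ {false} {false} _ = refl
xor≡false⇒≡ {true}  {true}  _ = refl

-- In the sum of all three disagreements the terms of (x , y) and (y , x) agree,
-- hence they cancel modulo 2.
disagreement-trans : ∀ {n} {r s t : Fin n → ℕ} →
  InjectiveRank r → InjectiveRank s → InjectiveRank t →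
  disagreement r t ≡ disagreement r s xor disagreement s t
disagreement-trans {r = r} {s} {t} r-inj s-inj t-inj = sym (xor≡false⇒≡ (begin
  (disagreement r s xor disagreement s t) xor disagreement r t
    ≡⟨ cong (_xor disagreement r t) (xor-double-sum-distrib (pair r s) (pair s t)) ⟨
  Xor.sum (λ x → Xor.sum λ y → pair r s x y xor pair s t x y) xor disagreement r t
    ≡⟨ xor-double-sum-distrib (λ x y → pair r s x y xor pair s t x y) (pair r t) ⟨
  Xor.sum (λ x → Xor.sum (total x))
    ≡⟨ xor-double-sum-symmetric total total-diag total-sym ⟩
  false ∎))
  where
  open ≡-Reasoning
  pair : (r s : Fin _ → ℕ) → Fin _ → Fin _ → Bool
  pair r s x y = (r x <ᵇ r y) ∧ (s y <ᵇ s x)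
  total : Fin _ → Fin _ → Bool
  total x y = (pair r s x y xor pair s t x y) xor pair r t x y
  total-diag : ∀ x → total x x ≡ false
  total-diag x rewrite <ᵇ-irrefl (r x) | <ᵇ-irrefl (s x) = refl
  table : ∀ a b c → ((a ∧ not b) xor (b ∧ not c)) xor (a ∧ not c) ≡
                    ((not a ∧ b) xor (not b ∧ c)) xor (not a ∧ c)
  table false false false = refl
  table false false true  = refl
  table false true  false = refl
  table false true  true  = refl
  table true  false false = refl
  table true  false true  = refl
  table true  true  false = refl
  table true  true  true  = refl
  total-sym : ∀ x y → total x y ≡ total y x
  total-sym x y with x ≟ y
  ... | yes refl = refl
  ... | no x≢y
    -- Off the diagonal there are no ties, so reversing a comparison negates it and three truth
    -- values decide everything.
    rewrite <ᵇ-flip (x≢y ∘ r-inj) | <ᵇ-flip (x≢y ∘ s-inj) | <ᵇ-flip (x≢y ∘ t-inj)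
    = table (r x <ᵇ r y) (s x <ᵇ s y) (t x <ᵇ t y)

-- Applying `π` to both rankings only reindexes the two sums.
disagreement-permute : ∀ {n} (r s : Fin n → ℕ) (π : Permutation n n) →
  disagreement (r ∘ (π ⟨$⟩ʳ_)) (s ∘ (π ⟨$⟩ʳ_)) ≡ disagreement r s
disagreement-permute r s π = sym (trans
  (sum-permute (λ x → Xor.sum λ y → (r x <ᵇ r y) ∧ (s y <ᵇ s x)) π)
  (sum-cong-≗ λ x → sum-permute (λ y → (r (π ⟨$⟩ʳ x) <ᵇ r y) ∧ (s y <ᵇ s (π ⟨$⟩ʳ x))) π))

disagreement-congʳ : ∀ {n} (r : Fin n → ℕ) {s t : Fin n → ℕ} → s ≗ t →
  disagreement r s ≡ disagreement r t
disagreement-congʳ r s≗t =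
  xor-double-sum-cong λ x y → cong₂ (λ a b → (r x <ᵇ r y) ∧ (a <ᵇ b)) (s≗t y) (s≗t x)

module _ {n} {a b : Fin n} (a≢b : a ≢ b) where
  private
    -- Reduces comparisons around the transposition to a finite case analysis; `other` keeps the
    -- index so that `place` stays injective.
    data Place : Set where
      first second : Place
      other        : ℕ → Place

    place : Fin n → Place
    place x with x ≟ a | x ≟ b
    ... | yes _ | _     = first
    ... | no _  | yes _ = second
    ... | no _  | no _  = other (toℕ x)

    place-a : place a ≡ first
    place-a with a ≟ a
    ... | yes _  = refl
    ... | no a≢a = contradiction refl a≢a

    place-b : place b ≡ second
    place-b with b ≟ a | b ≟ b
    ... | yes b≡a | _      = contradiction (sym b≡a) a≢b
    ... | no _    | yes _  = refl
    ... | no _    | no b≢b = contradiction refl b≢b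

    place-other : ∀ {x} → x ≢ a → x ≢ b → place x ≡ other (toℕ x)
    place-other {x} x≢a x≢b with x ≟ a | x ≟ b
    ... | yes x≡a | _       = contradiction x≡a x≢a
    ... | no _    | yes x≡b = contradiction x≡b x≢b
    ... | no _    | no _    = refl

    place-injective : ∀ {x y} → place x ≡ place y → x ≡ y
    place-injective {x} {y} eq with x ≟ a | x ≟ b | y ≟ a | y ≟ b
    ... | yes x≡a | _       | yes y≡a | _       = trans x≡a (sym y≡a)
    ... | no _    | yes x≡b | no _    | yes y≡b = trans x≡b (sym y≡b)
    ... | no _    | no _    | no _    | no _    = toℕ-injective (other-injective eq)
      where
      other-injective : ∀ {i j} → other i ≡ other j → i ≡ j
      other-injective refl = refl
    place-injective () | yes _ | _     | no _  | yes _
    place-injective () | yes _ | _     | no _  | no _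
    place-injective () | no _  | yes _ | yes _ | _
    place-injective () | no _  | yes _ | no _  | no _
    place-injective () | no _  | no _  | yes _ | _
    place-injective () | no _  | no _  | no _  | yes _

    -- The shift by 2 reserves the ranks 0 and 1 for `a` and `b`; `after` is `before` with these two
    -- ranks exchanged.
    before after : Place → ℕ
    before first     = 0
    before second    = 1
    before (other i) = 2 + i
    after first      = 1
    after second     = 0
    after (other i)  = 2 + i

    before-injective : ∀ p q → before p ≡ before q → p ≡ q
    before-injective first     first     _    = refl
    before-injective second    second    _    = refl
    before-injective (other i) (other j) refl = refl

    rank : Fin n → ℕ
    rank = before ∘ place

    rank-injective : InjectiveRank rank
    rank-injective = place-injective ∘ before-injective _ _

    τ : Fin n → Fin n
    τ = PC.transpose a b

    rank-τ : rank ∘ τ ≗ after ∘ place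
    rank-τ x = by-cases (x ≟ a) (x ≟ b)
      where
      by-cases : Dec (x ≡ a) → Dec (x ≡ b) → rank (τ x) ≡ after (place x)
      by-cases (yes refl) _
        rewrite transpose-left a b | place-a | place-b = refl
      by-cases (no x≢a) (yes refl)
        rewrite transpose-right a b | place-a | place-b = refl
      by-cases (no x≢a) (no x≢b)
        rewrite transpose-other a b x≢a x≢b | place-other x≢a x≢b = refl

    isFirst isSecond : Place → Bool
    isFirst first      = true
    isFirst second     = false
    isFirst (other _)  = false
    isSecond first     = false
    isSecond second    = true
    isSecond (other _) = false

    isFirst-place : ∀ x → x ≢ a → isFirst (place x) ≡ false
    isFirst-place x x≢a with x ≟ a | x ≟ b
    ... | yes x≡a | _     = contradiction x≡a x≢a
    ... | no _    | yes _ = refl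
    ... | no _    | no _  = refl

    isSecond-place : ∀ x → x ≢ b → isSecond (place x) ≡ false
    isSecond-place x x≢b with x ≟ a | x ≟ b
    ... | yes _ | _       = refl
    ... | no _  | yes x≡b = contradiction x≡b x≢b
    ... | no _  | no _    = refl

    <ᵇ-asym : ∀ m n → (m <ᵇ n) ∧ (n <ᵇ m) ≡ false
    <ᵇ-asym zero    zero    = refl
    <ᵇ-asym zero    (suc n) = refl
    <ᵇ-asym (suc m) zero    = refl
    <ᵇ-asym (suc m) (suc n) = <ᵇ-asym m n

    -- Ranks from 2 upwards are the same before and after, and stay above 0 and 1, so only the pair
    -- of `first` and `second` can be inverted.
    only-swapped-pair : ∀ p q →
      (before p <ᵇ before q) ∧ (after q <ᵇ after p) ≡ isFirst p ∧ isSecond q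
    only-swapped-pair first     first     = refl
    only-swapped-pair first     second    = refl
    only-swapped-pair first     (other j) = refl
    only-swapped-pair second    first     = refl
    only-swapped-pair second    second    = refl
    only-swapped-pair second    (other j) = refl
    only-swapped-pair (other i) first     = refl
    only-swapped-pair (other i) second    = refl
    only-swapped-pair (other i) (other j) = <ᵇ-asym i j

    rank-disagreement : disagreement rank (rank ∘ τ) ≡ true
    rank-disagreement = begin
      disagreement rank (rank ∘ τ)
        ≡⟨ disagreement-congʳ rank rank-τ ⟩
      disagreement rank (after ∘ place)
        ≡⟨ xor-double-sum-cong (λ x y → only-swapped-pair (place x) (place y)) ⟩
      Xor.sum (λ x → Xor.sum λ y → isFirst (place x) ∧ isSecond (place y))
        ≡⟨ xor-sum-single _ a (λ x x≢a → trans
             (sum-cong-≗ λ y → cong (_∧ isSecond (place y)) (isFirst-place x x≢a))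
             (sum-replicate-zero n)) ⟩
      Xor.sum (λ y → isFirst (place a) ∧ isSecond (place y))
        ≡⟨ sum-cong-≗ (λ y → cong (λ p → isFirst p ∧ isSecond (place y)) place-a) ⟩
      Xor.sum (λ y → isSecond (place y))
        ≡⟨ xor-sum-single _ b isSecond-place ⟩
      isSecond (place b)
        ≡⟨ cong isSecond place-b ⟩
      true ∎
      where open ≡-Reasoning

  -- Comparing with a ranking in which a and b come first, where the
  -- transposition reorders a single pair.
  disagreement-transpose : ∀ {r} → InjectiveRank r → disagreement r (r ∘ PC.transpose a b) ≡ true
  disagreement-transpose {r} r-inj = begin
    disagreement r (r ∘ τ)
      -- The comparison goes from `r` through `rank` and `rank ∘ τ` to `r ∘ τ`. The outer two legs
      -- have equal parity and cancel, which leaves the middle one.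
      ≡⟨ disagreement-trans r-inj rank-injective (τ-injective ∘ r-inj) ⟩
    disagreement r rank xor disagreement rank (r ∘ τ)
      ≡⟨ cong (disagreement r rank xor_)
           (disagreement-trans rank-injective (τ-injective ∘ rank-injective)
             (τ-injective ∘ r-inj)) ⟩
    disagreement r rank xor (disagreement rank (rank ∘ τ) xor disagreement (rank ∘ τ) (r ∘ τ))
      ≡⟨ cong₂ (λ s t → disagreement r rank xor (s xor t))
           rank-disagreement (disagreement-permute rank r (transpose a b)) ⟩
    disagreement r rank xor not (disagreement rank r)
      ≡⟨ not-distribʳ-xor (disagreement r rank) _ ⟨
    not (disagreement r rank xor disagreement rank r)
      ≡⟨ cong not (disagreement-trans r-inj rank-injective r-inj) ⟨
    not (disagreement r r)
      ≡⟨ cong not (disagreement-self r) ⟩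
    true ∎
    where
    open ≡-Reasoning
    τ-injective : ∀ {x y} → τ x ≡ τ y → x ≡ y
    τ-injective = to-injective (transpose a b)

-- The parity of the number of inversions, `true` for odd permutations.
sign : ∀ {m n} → Permutation m n → Bool
sign σ = disagreement toℕ (toℕ ∘ (σ ⟨$⟩ʳ_))

sign-cong : ∀ {m n} (σ ρ : Permutation m n) → (∀ x → σ ⟨$⟩ʳ x ≡ ρ ⟨$⟩ʳ x) → sign σ ≡ sign ρ
sign-cong σ ρ σ≈ρ = disagreement-congʳ toℕ (cong toℕ ∘ σ≈ρ)

sign-transpose : ∀ {m n} {a b : Fin m} → a ≢ b → (σ : Permutation m n) →
  sign (transpose a b ∘ₚ σ) ≡ not (sign σ)
sign-transpose {a = a} {b} a≢b σ = begin
  sign (transpose a b ∘ₚ σ)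
    ≡⟨ disagreement-trans toℕ-injective rσ-inj (to-injective (transpose a b) ∘ rσ-inj) ⟩
  sign σ xor disagreement rσ (rσ ∘ PC.transpose a b)
    ≡⟨ cong (sign σ xor_) (disagreement-transpose a≢b rσ-inj) ⟩
  sign σ xor true
    ≡⟨ xor-comm (sign σ) true ⟩
  not (sign σ) ∎
  where
  open ≡-Reasoning
  rσ = toℕ ∘ (σ ⟨$⟩ʳ_)
  rσ-inj : InjectiveRank rσ
  rσ-inj = to-injective σ ∘ toℕ-injective

-- Sums of natural numbers and counting below a threshold

module Sum where
  open import Algebra.Properties.CommutativeMonoid.Sum ℕ.+-0-commutativeMonoid public

sum-mono : ∀ {n} {f g : Fin n → ℕ} → (∀ i → f i ≤ g i) → Sum.sum f ≤ Sum.sum g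
sum-mono {zero}  f≤g = z≤n
sum-mono {suc n} f≤g = ℕ.+-mono-≤ (f≤g zero) (sum-mono (f≤g ∘ suc))

sum-bounded : ∀ {n} {f : Fin n → ℕ} → (∀ i → f i ≤ 1) → Sum.sum f ≤ n
sum-bounded {zero}  f≤1 = z≤n
sum-bounded {suc n} f≤1 = ℕ.+-mono-≤ (f≤1 zero) (sum-bounded (f≤1 ∘ suc))

-- The term at `i` escapes the comparison; adding the opposite value on each side avoids truncated
-- subtraction.
sum-mono-update : ∀ {n} (f g : Fin n → ℕ) (i : Fin n) → (∀ j → j ≢ i → f j ≤ g j) →
  Sum.sum f + g i ≤ Sum.sum g + f i
sum-mono-update {suc n} f g i f≤g = begin
  Sum.sum f + g i                            ≡⟨ cong (_+ g i) (Sum.sum-remove {i = i} f) ⟩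
  f i + Sum.sum (f ∘ punchIn i) + g i        ≤⟨ ℕ.+-monoˡ-≤ (g i) (ℕ.+-monoʳ-≤ (f i)
                                                  (sum-mono λ j → f≤g _ (punchInᵢ≢i i j))) ⟩
  f i + s + g i                              ≡⟨ ℕ.+-comm (f i + s) (g i) ⟩
  g i + (f i + s)                            ≡⟨ cong (g i +_) (ℕ.+-comm (f i) s) ⟩
  g i + (s + f i)                            ≡⟨ ℕ.+-assoc (g i) s (f i) ⟨
  g i + s + f i                              ≡⟨ cong (_+ f i) (Sum.sum-remove {i = i} g) ⟨
  Sum.sum g + f i                            ∎
  where
  open ℕ.≤-Reasoning
  s = Sum.sum (g ∘ punchIn i)

-- The indicator of `x < i`, with values in `ℕ` so that its sums are counts.
below : ℕ → ℕ → ℕ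
below x       zero    = 0
below zero    (suc i) = 1
below (suc x) (suc i) = below x i

below-< : ∀ {x i} → x < i → below x i ≡ 1
below-< {zero}  {suc i} _         = refl
below-< {suc x} {suc i} (s≤s x<i) = below-< x<i

below-≥ : ∀ {x i} → i ≤ x → below x i ≡ 0
below-≥ {x}     {zero}  _         = refl
below-≥ {suc x} {suc i} (s≤s i≤x) = below-≥ i≤x

below≤1 : ∀ x i → below x i ≤ 1
below≤1 x       zero    = z≤n
below≤1 zero    (suc i) = ℕ.≤-refl
below≤1 (suc x) (suc i) = below≤1 x i

below-mono : ∀ {x y i j} → (x < i → y < j) → below x i ≤ below y j
below-mono {x} {y} {i} {j} imp with x ℕ.<? i
... | yes x<i rewrite below-< x<i | below-< (imp x<i) = ℕ.≤-refl
... | no x≮i rewrite below-≥ (ℕ.≮⇒≥ x≮i) = z≤n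

-- Cyclic orientation of three positions

<ᵇ-≥ : ∀ {m n} → n ≤ m → (m <ᵇ n) ≡ false
<ᵇ-≥ {m}     {zero}  _         = refl
<ᵇ-≥ {suc m} {suc n} (s≤s n≤m) = <ᵇ-≥ n≤m

<ᵇ-sucˡ : ∀ {m n} → n ≢ suc m → (suc m <ᵇ n) ≡ (m <ᵇ n)
<ᵇ-sucˡ {m}     {zero}        _ = refl
<ᵇ-sucˡ {zero}  {suc zero}    ≢ = contradiction refl ≢
<ᵇ-sucˡ {zero}  {suc (suc n)} _ = refl
<ᵇ-sucˡ {suc m} {suc n}       ≢ = <ᵇ-sucˡ (≢ ∘ cong suc)

<ᵇ-sucʳ : ∀ {m n} → m ≢ n → (m <ᵇ suc n) ≡ (m <ᵇ n)
<ᵇ-sucʳ {zero}  {zero}  ≢ = contradiction refl ≢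
<ᵇ-sucʳ {zero}  {suc n} _ = refl
<ᵇ-sucʳ {suc m} {zero}  _ = refl
<ᵇ-sucʳ {suc m} {suc n} ≢ = <ᵇ-sucʳ (≢ ∘ cong suc)

-- For distinct i, j and l this is the cyclic orientation of the triple.
orientation : ℕ → ℕ → ℕ → Bool
orientation i j l = ((i <ᵇ j) xor (j <ᵇ l)) xor (l <ᵇ i)

orientation-rotate : ∀ i j l → orientation i j l ≡ orientation j l i
orientation-rotate i j l = trans (xor-assoc (i <ᵇ j) _ _) (xor-comm (i <ᵇ j) _)

-- The exchange reverses all three comparisons, and three negations amount to one modulo 2.
orientation-swap : ∀ {i j l} → i ≢ j → j ≢ l → l ≢ i → orientation j i l ≡ not (orientation i j l)
orientation-swap {i} {j} {l} i≢j j≢l l≢i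
  rewrite <ᵇ-flip i≢j | <ᵇ-flip j≢l | <ᵇ-flip l≢i = table (i <ᵇ j) (j <ᵇ l) (l <ᵇ i)
  where
  table : ∀ a b c → (not a xor not c) xor not b ≡ not ((a xor b) xor c)
  table false false false = refl
  table false false true  = refl
  table false true  false = refl
  table false true  true  = refl
  table true  false false = refl
  table true  false true  = refl
  table true  true  false = refl
  table true  true  true  = refl

-- An ordinary step alters no comparison with `j` or `l`, as neither is the vertex left or entered.
-- The step from the last vertex to 0 reverses both comparisons with `i`, and the two changes
-- cancel.
orientation-next : ∀ {n i i′ j l} → suc i ≡ i′ ⊎ (suc i ≡ n × i′ ≡ 0) → j < n → l < n →
  j ≢ i → l ≢ i → j ≢ i′ → l ≢ i′ → orientation i′ j l ≡ orientation i j l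
orientation-next {j = j} {l} (inj₁ refl) _ _ j≢i l≢i j≢i′ l≢i′ =
  cong₂ (λ a b → (a xor (j <ᵇ l)) xor b) (<ᵇ-sucˡ j≢i′) (<ᵇ-sucʳ l≢i)
orientation-next {j = zero} (inj₂ (refl , refl)) _ _ _ _ j≢0 _ = contradiction refl j≢0
orientation-next {i = i} {j = suc j} {l} (inj₂ (refl , refl)) (s≤s j<i) (s≤s l≤i) _ l≢i _ _
  rewrite <ᵇ-≥ j<i | <ᵇ-flip (l≢i ∘ sym) | <ᵇ-≥ l≤i
  = trans (xor-identityʳ _) (xor-comm true (suc j <ᵇ l))

-- Token configurations and their moves

module _ {p q n : ℕ} (Y : FinGraph n) where
  open Graph Y using (_~_) renaming (~-sym to ~-symʸ)
  private
    X = K p q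
    Config = Permutation (p + q) n
    module F = Graph (FS X Y)

  black : Config → Fin p → Fin n
  black σ i = σ ⟨$⟩ʳ (i ↑ˡ q)

  white : Config → Fin q → Fin n
  white σ j = σ ⟨$⟩ʳ (p ↑ʳ j)

  black-injective : ∀ σ {i j} → black σ i ≡ black σ j → i ≡ j
  black-injective σ = ↑ˡ-injective q _ _ ∘ to-injective σ

  white-injective : ∀ σ {i j} → white σ i ≡ white σ j → i ≡ j
  white-injective σ = ↑ʳ-injective p _ _ ∘ to-injective σ

  ↑ˡ≢↑ʳ : ∀ (i : Fin p) (j : Fin q) → i ↑ˡ q ≢ p ↑ʳ j
  ↑ˡ≢↑ʳ i j eq = ℕ.<⇒≱ (toℕ<n i) (subst (p ≤_) (begin
    p + toℕ j     ≡⟨ toℕ-↑ʳ p j ⟨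
    toℕ (p ↑ʳ j)  ≡⟨ cong toℕ eq ⟨
    toℕ (i ↑ˡ q)  ≡⟨ toℕ-↑ˡ i q ⟩
    toℕ i         ∎) (ℕ.m≤m+n p (toℕ j)))
    where open ≡-Reasoning

  -- An edge of `K p q` has one end in each part. Naming the black end first merges the two
  -- symmetric cases of adjacency.
  record Move (σ σ′ : Config) : Set where
    constructor move
    field
      b           : Fin p
      w           : Fin q
      edge        : black σ b ~ white σ w
      black-moves : black σ′ b ≡ white σ w
      white-moves : white σ′ w ≡ black σ b
      others      : ∀ c → c ≢ b ↑ˡ q → c ≢ p ↑ʳ w → σ′ ⟨$⟩ʳ c ≡ σ ⟨$⟩ʳ c

    blacks-stay : ∀ i → i ≢ b → black σ′ i ≡ black σ i
    blacks-stay i i≢b = others _ (i≢b ∘ ↑ˡ-injective q _ _) (↑ˡ≢↑ʳ i w)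

    whites-stay : ∀ j → j ≢ w → white σ′ j ≡ white σ j
    whites-stay j j≢w = others _ (↑ˡ≢↑ʳ b j ∘ sym) (j≢w ∘ ↑ʳ-injective p _ _)

    -- Presents the move as a transposition of tokens, so that `sign-transpose` applies to it.
    σ′≈transpose : ∀ x → σ′ ⟨$⟩ʳ x ≡ (transpose (b ↑ˡ q) (p ↑ʳ w) ∘ₚ σ) ⟨$⟩ʳ x
    σ′≈transpose x = by-cases (x ≟ b ↑ˡ q) (x ≟ p ↑ʳ w)
      where
      by-cases : Dec (x ≡ b ↑ˡ q) → Dec (x ≡ p ↑ʳ w) →
        σ′ ⟨$⟩ʳ x ≡ σ ⟨$⟩ʳ PC.transpose (b ↑ˡ q) (p ↑ʳ w) x
      by-cases (yes refl) _ =
        trans black-moves (cong (σ ⟨$⟩ʳ_) (sym (transpose-left (b ↑ˡ q) (p ↑ʳ w))))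
      by-cases (no _) (yes refl) =
        trans white-moves (cong (σ ⟨$⟩ʳ_) (sym (transpose-right (b ↑ˡ q) (p ↑ʳ w))))
      by-cases (no x≢b) (no x≢w) =
        trans (others x x≢b x≢w) (cong (σ ⟨$⟩ʳ_) (sym (transpose-other _ _ x≢b x≢w)))

  private
    left-part : ∀ {x} → toℕ x < p → ∃ λ (i : Fin p) → i ↑ˡ q ≡ x
    left-part {x} x<p = fromℕ< x<p , splitAt⁻¹-↑ˡ (splitAt-< p x x<p)

    right-part : ∀ {x} → p ≤ toℕ x → ∃ λ (j : Fin q) → p ↑ʳ j ≡ x
    right-part {x} p≤x = reduce≥ x p≤x , splitAt⁻¹-↑ʳ (splitAt-≥ p x p≤x)

  toMove : ∀ {σ σ′} → σ F.~ σ′ → Move σ σ′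
  toMove (x , y , inj₁ (x<p , p≤y) , xy , σx , σy , rest)
    with left-part x<p | right-part p≤y
  ... | b , refl | w , refl = move b w xy (sym σy) (sym σx) λ c c≢b c≢w → sym (rest c c≢b c≢w)
  toMove (x , y , inj₂ (p≤x , y<p) , xy , σx , σy , rest)
    with left-part y<p | right-part p≤x
  ... | b , refl | w , refl =
    move b w (~-symʸ xy) (sym σx) (sym σy) λ c c≢b c≢w → sym (rest c c≢w c≢b)

  -- The common form of all four arguments: if the graph were connected, a property kept by moves
  -- would pass between arbitrary configurations.
  invariant-preserved : (P : Config → Set) → (∀ σ τ → (∀ x → σ ⟨$⟩ʳ x ≡ τ ⟨$⟩ʳ x) → P σ → P τ) →
    (∀ {σ τ} → Move σ τ → P σ → P τ) → Connected (FS X Y) → ∀ σ τ → P σ → P τ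
  invariant-preserved P resp step connected σ τ =
    reachable-preserves (FS X Y) P (resp _ _) (step ∘ toMove) (connected σ τ)

  -- The unreachable target for bipartite graphs and cycles: it leaves every black token in place
  -- but alters the invariant.
  swapWhites : Config → Fin q → Fin q → Config
  swapWhites σ i j = transpose (p ↑ʳ i) (p ↑ʳ j) ∘ₚ σ

  white-swapWhites-left : ∀ σ i j → white (swapWhites σ i j) i ≡ white σ j
  white-swapWhites-left σ i j = cong (σ ⟨$⟩ʳ_) (transpose-left (p ↑ʳ i) (p ↑ʳ j))

  white-swapWhites-right : ∀ σ i j → white (swapWhites σ i j) j ≡ white σ i
  white-swapWhites-right σ i j = cong (σ ⟨$⟩ʳ_) (transpose-right (p ↑ʳ i) (p ↑ʳ j))

  white-swapWhites-other : ∀ σ i j {k} → k ≢ i → k ≢ j → white (swapWhites σ i j) k ≡ white σ k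
  white-swapWhites-other σ i j k≢i k≢j = cong (σ ⟨$⟩ʳ_)
    (transpose-other _ _ (k≢i ∘ ↑ʳ-injective p _ _) (k≢j ∘ ↑ʳ-injective p _ _))

  black-swapWhites : ∀ σ i j b → black (swapWhites σ i j) b ≡ black σ b
  black-swapWhites σ i j b = cong (σ ⟨$⟩ʳ_) (transpose-other _ _ (↑ˡ≢↑ʳ b i) (↑ˡ≢↑ʳ b j))

  -- Disconnected graphs

  -- Each move carries a token along an edge of `Y` or leaves it where it is, so the journey of one
  -- token from `x` to `y` traces a path.
  connected⇒connected : p + q ≡ n → Fin (p + q) → Connected (FS X Y) → Connected Y
  connected⇒connected p+q≡n token connected x y =
    let σ , σ-token = placing p+q≡n token x
        τ , τ-token = placing p+q≡n token y
        z , path , z≡ = invariant-preserved (λ ρ → Reachable Y x (ρ ⟨$⟩ʳ token))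
          (λ _ _ σ≈τ (z , path , z≡) → z , path , trans z≡ (σ≈τ token))
          step connected σ τ (x , ε , sym σ-token)
    in z , path , trans z≡ τ-token
    where
    step : ∀ {σ τ} → Move σ τ → Reachable Y x (σ ⟨$⟩ʳ token) → Reachable Y x (τ ⟨$⟩ʳ token)
    step {σ} {τ} m (_ , path , refl) = by-cases (token ≟ b ↑ˡ q) (token ≟ p ↑ʳ w)
      where
      open Move m
      by-cases : Dec (token ≡ b ↑ˡ q) → Dec (token ≡ p ↑ʳ w) → Reachable Y x (τ ⟨$⟩ʳ token)
      by-cases (yes refl) _ = _ , path ◅◅ edge ◅ ε , sym black-moves
      by-cases (no _) (yes refl) = _ , path ◅◅ ~-symʸ edge ◅ ε , sym white-moves
      by-cases (no ≢b) (no ≢w) = _ , path , sym (others token ≢b ≢w)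

  -- Bipartite graphs

  bipartite⇒disconnected : p + q ≡ n → 2 ≤ q → Bipartite Y → Disconnected (FS X Y)
  bipartite⇒disconnected p+q≡n 2≤q (colour , _ , proper) connected =
    not-¬ refl (begin
      parity σ
        ≡⟨ invariant-preserved (λ τ → parity τ ≡ parity σ)
             (λ ρ τ σ≈τ → trans (sym (cong₂ _xor_ (sign-cong ρ τ σ≈τ)
               (sum-cong-≗ λ b → cong colour (σ≈τ (b ↑ˡ q))))))
             (λ m → trans (step m)) connected σ (swapWhites σ j₀ j₁) refl ⟨
      parity (swapWhites σ j₀ j₁)
        -- The black tokens keep their vertices, so only the sign changes.
        ≡⟨ cong₂ _xor_ (sign-transpose (j₀≢j₁ ∘ ↑ʳ-injective p _ _) σ)
             (sum-cong-≗ λ b → cong colour (black-swapWhites σ j₀ j₁ b)) ⟩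
      not (sign σ) xor Xor.sum (colour ∘ black σ)
        ≡⟨ not-distribˡ-xor (sign σ) _ ⟨
      not (parity σ) ∎)
    where
    open ≡-Reasoning
    σ = cast-id p+q≡n
    j₀ j₁ : Fin q
    j₀ = fromℕ< (ℕ.≤-trans (s≤s z≤n) 2≤q)
    j₁ = fromℕ< 2≤q
    j₀≢j₁ : j₀ ≢ j₁
    j₀≢j₁ eq with trans (sym (toℕ-fromℕ< _)) (trans (cong toℕ eq) (toℕ-fromℕ< 2≤q))
    ... | ()

    parity : Config → Bool
    parity σ = sign σ xor Xor.sum (colour ∘ black σ)

    differ : ∀ u t c → u xor c ≡ t xor not c → u ≡ not t
    differ false true  c     _  = refl
    differ true  false c     _  = refl
    differ false false false ()
    differ false false true  ()
    differ true  true  false ()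
    differ true  true  true  ()

    step : ∀ {σ τ} → Move σ τ → parity τ ≡ parity σ
    step {σ} {τ} m = begin
      sign τ xor Xor.sum (colour ∘ black τ)
        ≡⟨ cong₂ _xor_ sign-flips colours-flip ⟩
      not (sign σ) xor not (Xor.sum (colour ∘ black σ))
        ≡⟨ xor-annihilates-not (sign σ) _ ⟩
      parity σ ∎
      where
      open Move m
      sign-flips : sign τ ≡ not (sign σ)
      sign-flips = trans (sign-cong τ (transpose (b ↑ˡ q) (p ↑ʳ w) ∘ₚ σ) σ′≈transpose)
        (sign-transpose (↑ˡ≢↑ʳ b w) σ)
      colours-flip : Xor.sum (colour ∘ black τ) ≡ not (Xor.sum (colour ∘ black σ))
      -- Of the black tokens only `b` moves, and its edge leads to the other colour class.
      colours-flip = differ _ _ (colour (black σ b)) (begin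
        Xor.sum (colour ∘ black τ) xor colour (black σ b)
          ≡⟨ xor-sum-update (colour ∘ black τ) (colour ∘ black σ) b
               (λ i i≢b → cong colour (blacks-stay i i≢b)) ⟩
        Xor.sum (colour ∘ black σ) xor colour (black τ b)
          ≡⟨ cong (λ y → Xor.sum (colour ∘ black σ) xor colour y) black-moves ⟩
        Xor.sum (colour ∘ black σ) xor colour (white σ w)
          ≡⟨ cong (Xor.sum (colour ∘ black σ) xor_) (¬-not (proper (~-symʸ edge))) ⟩
        Xor.sum (colour ∘ black σ) xor not (colour (black σ b)) ∎)

  -- Bridges

  -- On the heights 1, …, p a white token passes a black one with every step, and
  -- no other token can cross it.
  module _ (h : Fin n → ℕ)
    (h-step : ∀ {x y} → x ~ y → h y ≤ suc (h x))
    (h-unique : ∀ {x y} → 1 ≤ h x → h x ≤ p → h x ≡ h y → x ≡ y) where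

    private
      blacksBelow : Config → ℕ → ℕ
      blacksBelow σ i = Sum.sum λ b → below (h (black σ b)) i

      -- Automatic at height 0 and impossible above `p`, since there are only `p` black tokens to
      -- count.
      Supported : Fin q → Config → Set
      Supported w σ = h (white σ w) ≤ blacksBelow σ (h (white σ w))

      supported⇒≤p : ∀ w σ → Supported w σ → h (white σ w) ≤ p
      supported⇒≤p w σ supp = ℕ.≤-trans supp
        (sum-bounded λ b → below≤1 (h (black σ b)) (h (white σ w)))

      supported-move : ∀ v {σ τ} → Move σ τ → Supported v σ → Supported v τ
      supported-move v {σ} {τ} m supp = by-cases (v ≟ w)
        where
        open Move m

        i i′ : ℕ
        i  = h (white σ v)
        i′ = h (black σ b)

        i≤p : i ≤ p
        i≤p = supported⇒≤p v σ supp

        moves : v ≡ w → Supported v τ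
        moves refl rewrite white-moves = compare (ℕ.<-cmp i i′)
          where
          -- The other black tokens are compared one by one. Token `b` trades heights with the white
          -- token and accounts for the two extra terms.
          update : (∀ c → c ≢ b → h (black σ c) < i → h (black σ c) < i′) →
            blacksBelow σ i + below i i′ ≤ blacksBelow τ i′ + below i′ i
          update imp = subst
            (λ x → blacksBelow σ i + below (h x) i′ ≤ blacksBelow τ i′ + below i′ i)
            black-moves
            (sum-mono-update (λ c → below (h (black σ c)) i) (λ c → below (h (black τ c)) i′) b
              λ c c≢b → below-mono (subst (λ x → h (black σ c) < i → h x < i′)
                (sym (blacks-stay c c≢b)) (imp c c≢b)))

          compare : Tri (i < i′) (i ≡ i′) (i′ < i) → i′ ≤ blacksBelow τ i′
          -- The white token climbs by one and gains `b`, which is now below it.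
          compare (tri< i<i′ _ _) = begin
            i′                                ≤⟨ h-step (~-symʸ edge) ⟩
            suc i                             ≤⟨ s≤s supp ⟩
            suc (blacksBelow σ i)             ≡⟨ ℕ.+-comm 1 _ ⟩
            blacksBelow σ i + 1               ≡⟨ cong (blacksBelow σ i +_) (below-< i<i′) ⟨
            blacksBelow σ i + below i i′      ≤⟨ update (λ c _ <i → ℕ.<-trans <i i<i′) ⟩
            blacksBelow τ i′ + below i′ i     ≡⟨ cong (blacksBelow τ i′ +_) (below-≥ (ℕ.<⇒≤ i<i′)) ⟩
            blacksBelow τ i′ + 0              ≡⟨ ℕ.+-identityʳ _ ⟩
            blacksBelow τ i′                  ∎
            where open ℕ.≤-Reasoning
          compare (tri≈ _ i≡i′ _) = begin
            i′                                ≡⟨ i≡i′ ⟨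
            i                                 ≤⟨ supp ⟩
            blacksBelow σ i                   ≤⟨ ℕ.m≤m+n _ _ ⟩
            blacksBelow σ i + below i i′      ≤⟨ update (λ c _ → subst (h (black σ c) <_) i≡i′) ⟩
            blacksBelow τ i′ + below i′ i     ≡⟨ cong (blacksBelow τ i′ +_)
                                                   (below-≥ (ℕ.≤-reflexive i≡i′)) ⟩
            blacksBelow τ i′ + 0              ≡⟨ ℕ.+-identityʳ _ ⟩
            blacksBelow τ i′                  ∎
            where open ℕ.≤-Reasoning
          compare (tri> _ _ i′<i) = positive (1 ℕ.≤? i′)
            where
            positive : Dec (1 ≤ i′) → i′ ≤ blacksBelow τ i′
            -- At height 0 nothing is required; from height 1 on, `h-unique` becomes available.
            positive (no i′≱1) rewrite ℕ.n<1⇒n≡0 (ℕ.≰⇒> i′≱1) = z≤n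
            positive (yes 1≤i′) = s≤s⁻¹ (begin
              suc i′                            ≤⟨ i′<i ⟩
              i                                 ≤⟨ supp ⟩
              blacksBelow σ i                   ≤⟨ ℕ.m≤m+n _ _ ⟩
              blacksBelow σ i + below i i′      ≤⟨ update lower ⟩
              blacksBelow τ i′ + below i′ i     ≤⟨ ℕ.+-monoʳ-≤ _ (below≤1 i′ i) ⟩
              blacksBelow τ i′ + 1              ≡⟨ ℕ.+-comm _ 1 ⟩
              suc (blacksBelow τ i′)            ∎)
              where
              open ℕ.≤-Reasoning
              -- The white token descends by one and may lose only `b`: a black token below `i` has
              -- height at most `i′`, and `b` held the only vertex of height `i′`.
              lower : ∀ c → c ≢ b → h (black σ c) < i → h (black σ c) < i′
              lower c c≢b <i = ℕ.≤∧≢⇒< (s≤s⁻¹ (ℕ.≤-trans <i (h-step edge)))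
                λ eq → c≢b (sym (black-injective σ
                  (h-unique 1≤i′ (ℕ.≤-trans (ℕ.<⇒≤ i′<i) i≤p) (sym eq))))

        stays : v ≢ w → Supported v τ
        stays v≢w rewrite whites-stay v v≢w =
          ℕ.≤-trans supp (sum-mono λ c → below-mono (still-below c (c ≟ b)))
          where
          still-below : ∀ c → Dec (c ≡ b) → h (black σ c) < i → h (black τ c) < i
          still-below c (no c≢b) <i = subst (λ x → h x < i) (sym (blacks-stay c c≢b)) <i
          -- One step lifts `b` at most to height `i`, and the only vertex of that height is held by
          -- `v`, which did not move.
          still-below c (yes refl) <i rewrite black-moves =
            ℕ.≤∧≢⇒< (ℕ.≤-trans (h-step edge) <i)
              λ eq → v≢w (white-injective σ
                (h-unique (ℕ.≤-trans (s≤s z≤n) <i) i≤p (sym eq)))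

        by-cases : Dec (v ≡ w) → Supported v τ
        by-cases (yes v≡w) = moves v≡w
        by-cases (no v≢w)  = stays v≢w

    -- The white token `w` is supported at `x` for free; connectedness would carry it, still
    -- supported, to `y`, which is too high.
    bridge⇒disconnected : p + q ≡ n → Fin q → ∀ {x y} → h x ≡ 0 → p < h y → Disconnected (FS X Y)
    bridge⇒disconnected p+q≡n w {x} {y} hx≡0 p<hy connected =
      let σ , σ-w = placing p+q≡n (p ↑ʳ w) x
          τ , τ-w = placing p+q≡n (p ↑ʳ w) y
          supp = invariant-preserved (Supported w) resp (supported-move w) connected σ τ
                   (subst (λ i → i ≤ blacksBelow σ i) (sym (trans (cong h σ-w) hx≡0)) z≤n)
      in ℕ.<⇒≱ p<hy (subst (λ z → h z ≤ p) τ-w (supported⇒≤p w τ supp))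
      where
      resp : ∀ σ τ → (∀ c → σ ⟨$⟩ʳ c ≡ τ ⟨$⟩ʳ c) → Supported w σ → Supported w τ
      resp σ τ σ≈τ supp = subst₂ _≤_ (cong h (σ≈τ _))
        (Sum.sum-cong-≗ λ b → cong₂ (λ y z → below (h y) (h z)) (σ≈τ (b ↑ˡ q)) (σ≈τ (p ↑ʳ w))) supp

  -- Cycles

  cycle⇒disconnected : p + q ≡ n → 3 ≤ q → (f : Fin n → Fin n) → (∀ {x y} → f x ≡ f y → x ≡ y) →
    (∀ {x y} → x ~ y → Graph._~_ (C n) (f x) (f y)) → Disconnected (FS X Y)
  -- Matching on `3 ≤ q` exposes three successors in `q`, so that `0F`, `1F` and `2F` are white
  -- tokens.
  cycle⇒disconnected p+q≡n (s≤s (s≤s (s≤s z≤n))) f f-inj f-edge connected =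
    not-¬ refl (begin
      orient σ
        ≡⟨ invariant-preserved (λ τ → orient τ ≡ orient σ) resp (λ m → trans (orient-move m))
             connected σ (swapWhites σ 0F 1F) refl ⟨
      orient (swapWhites σ 0F 1F)
        ≡⟨ orientation-cong (cong pos (white-swapWhites-left σ 0F 1F))
             (cong pos (white-swapWhites-right σ 0F 1F))
             (cong pos (white-swapWhites-other σ 0F 1F (λ ()) (λ ()))) ⟩
      orientation (pos (white σ 1F)) (pos (white σ 0F)) (pos (white σ 2F))
        ≡⟨ orientation-swap (apart σ λ ()) (apart σ λ ()) (apart σ λ ()) ⟩
      not (orient σ) ∎)
    where
    open ≡-Reasoning
    σ = cast-id p+q≡n

    pos : Fin n → ℕ
    pos = toℕ ∘ f

    pos-injective : ∀ {x y} → pos x ≡ pos y → x ≡ y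
    pos-injective = f-inj ∘ toℕ-injective

    orient : Config → Bool
    orient σ = orientation (pos (white σ 0F)) (pos (white σ 1F)) (pos (white σ 2F))

    orientation-cong : ∀ {i i′ j j′ l l′} → i ≡ i′ → j ≡ j′ → l ≡ l′ →
      orientation i j l ≡ orientation i′ j′ l′
    orientation-cong refl refl refl = refl

    resp : ∀ (ρ τ : Config) → (∀ x → ρ ⟨$⟩ʳ x ≡ τ ⟨$⟩ʳ x) →
      orient ρ ≡ orient σ → orient τ ≡ orient σ
    resp _ _ ρ≈τ = trans (sym
      (orientation-cong (cong pos (ρ≈τ _)) (cong pos (ρ≈τ _)) (cong pos (ρ≈τ _))))

    apart : ∀ σ {i j} → i ≢ j → pos (white σ i) ≢ pos (white σ j)
    apart σ i≢j = i≢j ∘ white-injective σ ∘ pos-injective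

    orient-move : ∀ {σ τ} → Move σ τ → orient τ ≡ orient σ
    orient-move {σ} {τ} m = by-cases (w ≟ 0F) (w ≟ 1F) (w ≟ 2F)
      where
      open Move m

      triple : Config → (i j l : Fin q) → Bool
      triple ρ i j l = orientation (pos (white ρ i)) (pos (white ρ j)) (pos (white ρ l))

      -- Only a moving first entry is treated here; `rotate` brings any other moving token of the
      -- triple to the front.
      step : ∀ {i j l} → w ≡ i → j ≢ i → l ≢ i → triple τ i j l ≡ triple σ i j l
      step {i} {j} {l} refl j≢w l≢w rewrite whites-stay j j≢w | whites-stay l l≢w | white-moves =
        along (proj₂ (f-edge edge))
        where
        off-black : ∀ k → pos (white σ k) ≢ pos (black σ b)
        off-black k = ↑ˡ≢↑ʳ b k ∘ sym ∘ to-injective σ ∘ pos-injective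
        Next : Fin n → Fin n → Set
        Next x y = suc (toℕ x) ≡ toℕ y ⊎ (suc (toℕ x) ≡ n × toℕ y ≡ 0)
        along : Next (f (black σ b)) (f (white σ w)) ⊎ Next (f (white σ w)) (f (black σ b)) →
          orientation (pos (black σ b)) (pos (white σ j)) (pos (white σ l)) ≡
          orientation (pos (white σ w)) (pos (white σ j)) (pos (white σ l))
        along (inj₁ nx) = sym (orientation-next nx (toℕ<n _) (toℕ<n _)
          (off-black j) (off-black l) (apart σ j≢w) (apart σ l≢w))
        along (inj₂ nx) = orientation-next nx (toℕ<n _) (toℕ<n _)
          (apart σ j≢w) (apart σ l≢w) (off-black j) (off-black l)

      rotate : ∀ ρ i j l → triple ρ i j l ≡ triple ρ j l i
      rotate ρ i j l = orientation-rotate (pos (white ρ i)) (pos (white ρ j)) (pos (white ρ l))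

      by-cases : Dec (w ≡ 0F) → Dec (w ≡ 1F) → Dec (w ≡ 2F) → orient τ ≡ orient σ
      by-cases (yes w≡0) _ _ = step w≡0 (λ ()) (λ ())
      by-cases (no _) (yes w≡1) _ =
        trans (rotate τ 0F 1F 2F) (trans (step w≡1 (λ ()) (λ ())) (sym (rotate σ 0F 1F 2F)))
      by-cases (no _) (no _) (yes w≡2) =
        trans (sym (rotate τ 2F 0F 1F)) (trans (step w≡2 (λ ()) (λ ())) (rotate σ 2F 0F 1F))
      by-cases (no w≢0) (no w≢1) (no w≢2) =
        orientation-cong (cong pos (whites-stay 0F (w≢0 ∘ sym)))
          (cong pos (whites-stay 1F (w≢1 ∘ sym))) (cong pos (whites-stay 2F (w≢2 ∘ sym)))

-- Heights along a non-trivial bridge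

singleton-length : ∀ {A : Set} {v : A} {xs} → Unique xs → v ∈ xs →
  (∀ {y} → y ∈ xs → y ≡ v) → length xs ≡ 1
singleton-length {xs = _ ∷ []}    _              _ _  = refl
singleton-length {xs = _ ∷ _ ∷ _} ((x≢y ∷ _) ∷ _) _ ≡v =
  contradiction (trans (≡v (here refl)) (sym (≡v (there (here refl))))) x≢y

-- Otherwise the list counted by `degree` would be free of duplicates with `v` as its only member,
-- and thus have length 1.
other-neighbour : ∀ {m} (H : FinGraph m) (let open Graph H) {u v} → u ~ v → degree H u ≢ 1 →
  ∃ λ y → u ~ y × y ≢ v
other-neighbour H {u} {v} uv degree≢1 with any? (λ y → (u ~? y) ×-dec ¬? (y ≟ v))
  where open Graph H
... | yes found = found
... | no none   = contradiction
  (singleton-length (filter⁺ (u ~?_) (allFin⁺ _)) (∈-filter⁺ (u ~?_) (∈-allFin v) uv)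
    (λ {y} y∈ → decidable-stable (y ≟ v) λ y≢v →
      none (y , proj₂ (∈-filter⁻ (u ~?_) {xs = allFin _} y∈) , y≢v)))
  degree≢1
  where open Graph H

module _ {m} {H : FinGraph m} (H-connected : Connected H)
         {u v} (cutEdge : NonTrivialCutEdge H u v) where
  open Graph H
  open NonTrivialCutEdge cutEdge
  private
    module H-uv = Graph (removeEdge H u v)

  -- A path from `u` to `v` could replace the removed edge within every path of `H`, and the removal
  -- would not disconnect.
  cutEdge-separates : ¬ Star H-uv._~_ u v
  cutEdge-separates uv-path = cut λ x y →
    let z , path , z≡y = H-connected x y in z , reroute path , z≡y
    where
    detour : ∀ {x y} → x ~ y → Star H-uv._~_ x y
    detour {x} {y} xy with x ≟ u | y ≟ v | x ≟ v | y ≟ u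
    ... | yes refl | yes refl | _        | _        = uv-path
    ... | _        | _        | yes refl | yes refl = reverse H-uv.~-sym uv-path
    ... | no x≢u   | _        | no x≢v   | _        =
      (xy , λ { (inj₁ (x≡u , _)) → x≢u x≡u ; (inj₂ (x≡v , _)) → x≢v x≡v }) ◅ ε
    ... | no x≢u   | _        | _        | no y≢u   =
      (xy , λ { (inj₁ (x≡u , _)) → x≢u x≡u ; (inj₂ (_ , y≡u)) → y≢u y≡u }) ◅ ε
    ... | _        | no y≢v   | no x≢v   | _        =
      (xy , λ { (inj₁ (_ , y≡v)) → y≢v y≡v ; (inj₂ (x≡v , _)) → x≢v x≡v }) ◅ ε
    ... | _        | no y≢v   | _        | no y≢u   =
      (xy , λ { (inj₁ (_ , y≡v)) → y≢v y≡v ; (inj₂ (_ , y≡u)) → y≢u y≡u }) ◅ ε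

    reroute : ∀ {x y} → Star _~_ x y → Star H-uv._~_ x y
    reroute ε           = ε
    reroute (xy ◅ path) = detour xy ◅◅ reroute path

  -- The sides of the cut as Booleans, so that heights can be computed from them.
  SideFunction : Set
  SideFunction = ∃ λ (side : Fin m → Bool) →
    (∀ {x y} → x H-uv.~ y → side x ≡ side y) × side u ≡ true × side v ≡ false

  -- Disconnectedness is a negation, so reachability may be taken as decidable.
  ¬¬-sideFunction : ¬ ¬ SideFunction
  ¬¬-sideFunction = ¬¬-map fromDecidable
    (sequence (RawMonad.rawApplicative ¬¬-Monad) λ x → ¬¬-excluded-middle)
    where
    fromDecidable : (∀ x → Dec (Star H-uv._~_ u x)) → SideFunction
    fromDecidable reach? =
      (λ x → does (reach? x)) ,
      along ,
      dec-true (reach? u) ε ,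
      dec-false (reach? v) cutEdge-separates
      where
      along : ∀ {x y} → x H-uv.~ y → does (reach? x) ≡ does (reach? y)
      along {x} {y} xy with reach? x | reach? y
      ... | yes _   | yes _   = refl
      ... | yes ux  | no ¬uy  = contradiction (ux ◅◅ xy ◅ ε) ¬uy
      ... | no ¬ux  | yes uy  = contradiction (uy ◅◅ H-uv.~-sym xy ◅ ε) ¬ux
      ... | no _    | no _    = refl

  module BridgeHeight (sideFunction : SideFunction) (j : ℕ) where
    private
      side = proj₁ sideFunction
      side-edge : ∀ {x y} → x H-uv.~ y → side x ≡ side y
      side-edge = proj₁ (proj₂ sideFunction)
      side-u = proj₁ (proj₂ (proj₂ sideFunction))
      side-v = proj₂ (proj₂ (proj₂ sideFunction))
      module S = Graph (subdivideEdge H edge j)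

    -- The bridge occupies the heights 1, …, 2 + j; the rest of the side of u
    -- is at height 0 and the rest of the side of v at height 3 + j.
    height : Fin m ⊎ Fin j → ℕ
    height (inj₁ x) =
      if side x then (if does (x ≟ u) then 1 else 0) else (if does (x ≟ v) then 2 + j else 3 + j)
    height (inj₂ i) = 2 + toℕ i

    height-u : height (inj₁ u) ≡ 1
    height-u rewrite side-u | dec-true (u ≟ u) refl = refl

    height-v : height (inj₁ v) ≡ 2 + j
    height-v rewrite side-v | dec-true (v ≟ v) refl = refl

    -- Non-triviality enters here: a second neighbour of `u` keeps its edge to `u` when the cut edge
    -- goes, hence lies on the same side.
    bottom : ∃ λ x → height x ≡ 0
    bottom with other-neighbour H edge degree-u
    ... | y , uy , y≢v
      with side-edge {u} {y} (uy , λ { (inj₁ (_ , y≡v)) → y≢v y≡v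
                                     ; (inj₂ (_ , y≡u)) → ~-irrefl (sym y≡u) uy })
    ... | same = inj₁ y , height-y
      where
      height-y : height (inj₁ y) ≡ 0
      height-y rewrite trans (sym same) side-u
                     | dec-false (y ≟ u) (λ y≡u → ~-irrefl (sym y≡u) uy) = refl

    top : ∃ λ x → height x ≡ 3 + j
    top with other-neighbour H (~-sym edge) degree-v
    ... | y , vy , y≢u
      with side-edge {v} {y} (vy , λ { (inj₁ (_ , y≡v)) → ~-irrefl (sym y≡v) vy
                                     ; (inj₂ (_ , y≡u)) → y≢u y≡u })
    ... | same = inj₁ y , height-y
      where
      height-y : height (inj₁ y) ≡ 3 + j
      height-y rewrite trans (sym same) side-v
                     | dec-false (y ≟ v) (λ y≡v → ~-irrefl (sym y≡v) vy) = refl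

    ascending : ∀ {h h′} → h′ ≡ suc h → h′ ≤ suc h
    ascending = ℕ.≤-reflexive

    descending : ∀ {h h′} → h ≡ suc h′ → h′ ≤ suc h
    descending refl = ℕ.m≤n+m _ 2

    direct : ∀ {x y} → j ≡ 0 × x ≡ u × y ≡ v → height (inj₁ y) ≡ suc (height (inj₁ x))
    direct (j≡0 , refl , refl) = trans height-v (trans (cong (2 +_) j≡0) (cong suc (sym height-u)))

    first-step : ∀ {x} {i : Fin j} → x ≡ u × toℕ i ≡ 0 → height (inj₂ i) ≡ suc (height (inj₁ x))
    first-step (refl , i≡0) = trans (cong (2 +_) i≡0) (cong suc (sym height-u))

    last-step : ∀ {y} {i : Fin j} → suc (toℕ i) ≡ j × y ≡ v →
      height (inj₁ y) ≡ suc (height (inj₂ i))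
    last-step (i+1≡j , refl) = trans height-v (cong (2 +_) (sym i+1≡j))

    height-step : ∀ x y → x S.~ y → height y ≤ suc (height x)
    -- An old edge stays on one side, where only two consecutive heights occur.
    height-step (inj₁ x) (inj₁ y) (inj₁ xy) rewrite side-edge xy with side y
    ... | true = lower (does (y ≟ u)) _
      where
      lower : ∀ b c → (if b then 1 else 0) ≤ suc c
      lower false c = z≤n
      lower true  c = s≤s z≤n
    ... | false = upper (does (y ≟ v)) (does (x ≟ v))
      where
      upper : ∀ b c → (if b then 2 + j else 3 + j) ≤ suc (if c then 2 + j else 3 + j)
      upper false false = ℕ.n≤1+n _
      upper false true  = ℕ.≤-refl
      upper true  false = ℕ.m≤n+m _ 2
      upper true  true  = ℕ.n≤1+n _
    height-step (inj₁ x) (inj₁ y) (inj₂ (inj₁ xy)) = ascending (direct xy)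
    height-step (inj₁ x) (inj₁ y) (inj₂ (inj₂ yx)) = descending (direct yx)
    height-step (inj₁ x) (inj₂ i) (inj₂ (inj₁ xi)) = ascending (first-step xi)
    height-step (inj₂ i) (inj₁ x) (inj₂ (inj₂ xi)) = descending (first-step xi)
    height-step (inj₂ i) (inj₂ k) (inj₂ (inj₁ ik)) = ascending (cong (2 +_) (sym ik))
    height-step (inj₂ i) (inj₂ k) (inj₂ (inj₂ ki)) = descending (cong (2 +_) (sym ki))
    height-step (inj₂ i) (inj₁ y) (inj₂ (inj₁ iy)) = ascending (last-step iy)
    height-step (inj₁ y) (inj₂ i) (inj₂ (inj₂ iy)) = descending (last-step iy)

    -- Inverts `height` on the bridge, which yields `height-unique`; the values at 0 and above
    -- `2 + j` are mere defaults.
    vertexAt : ℕ → Fin m ⊎ Fin j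
    vertexAt (suc (suc i)) with i ℕ.<? j
    ... | yes i<j = inj₂ (fromℕ< i<j)
    ... | no _    = inj₁ v
    vertexAt _ = inj₁ u

    vertexAt-height : ∀ x → 1 ≤ height x → height x ≤ 2 + j → vertexAt (height x) ≡ x
    vertexAt-height (inj₁ x) 1≤h h≤2+j with side x | x ≟ u | x ≟ v
    ... | true  | yes x≡u | _       = cong inj₁ (sym x≡u)
    ... | false | _       | yes x≡v with j ℕ.<? j
    ...   | yes j<j = contradiction j<j (ℕ.<-irrefl refl)
    ...   | no _    = cong inj₁ (sym x≡v)
    vertexAt-height (inj₁ x) ()  h≤2+j | true  | no _ | _
    vertexAt-height (inj₁ x) 1≤h h≤2+j | false | _    | no _ = contradiction h≤2+j ℕ.1+n≰n
    vertexAt-height (inj₂ i) _ _ with toℕ i ℕ.<? j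
    ... | yes i<j = cong inj₂ (fromℕ<-toℕ i i<j)
    ... | no i≮j  = contradiction (toℕ<n i) i≮j

    height-unique : ∀ {x y} → 1 ≤ height x → height x ≤ 2 + j → height x ≡ height y → x ≡ y
    height-unique {x} {y} 1≤h h≤2+j eq = begin
      x                   ≡⟨ vertexAt-height x 1≤h h≤2+j ⟨
      vertexAt (height x) ≡⟨ cong vertexAt eq ⟩
      vertexAt (height y) ≡⟨ vertexAt-height y (subst (1 ≤_) eq 1≤h) (subst (_≤ 2 + j) eq h≤2+j) ⟩
      y                   ∎
      where open ≡-Reasoning

-- From the hypotheses on `Y` to the invariants

≅-injective : ∀ {n} {W : Set} {Y : FinGraph n} {Z : Graph (setoid W)} (Y≅Z : Y ≅ Z) {x y} →
  Inverse.to (proj₁ Y≅Z) x ≡ Inverse.to (proj₁ Y≅Z) y → x ≡ y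
≅-injective (f , _) {x} {y} eq =
  trans (sym (Inverse.inverseʳ f refl)) (trans (cong (Inverse.from f) eq) (Inverse.inverseʳ f refl))

-- The bridge has as many vertices as there are black tokens, so its heights are exactly those on
-- which uniqueness is required.
nonTrivialBridge⇒disconnected : ∀ {j q n} (Y : FinGraph n) → 2 + j + q ≡ n → Fin q →
  NonTrivialBridge (2 + j) Y → Disconnected (FS (K (2 + j) q) Y)
nonTrivialBridge⇒disconnected {j} {q} {n} Y k+q≡n w bridge connected =
  -- The goal is a contradiction, so the side function may be extracted from its double negation.
  ¬¬-sideFunction H-connected cutEdge λ sides →
    let open BridgeHeight H-connected cutEdge sides j
        x , hx = bottom
        y , hy = top
    in bridge⇒disconnected Y (height ∘ f)
         (λ {x} {y} xy → height-step (f x) (f y) (Equivalence.to (proj₂ Y≅ x y) xy))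
         (λ 1≤h h≤k eq →
            ≅-injective {Y = Y} {Z = subdivideEdge H edge j} Y≅ (height-unique 1≤h h≤k eq))
         k+q≡n w
         (trans (cong height (f-from x)) hx)
         (ℕ.≤-reflexive (sym (trans (cong height (f-from y)) hy)))
         connected
  where
  open NonTrivialBridge bridge
  open NonTrivialCutEdge cutEdge
  f : Fin n → Fin m ⊎ Fin j
  f = Inverse.to (proj₁ Y≅)
  f-from : ∀ x → f (Inverse.from (proj₁ Y≅) x) ≡ x
  f-from x = Inverse.inverseˡ (proj₁ Y≅) refl

bipartite-≅ : ∀ {n} {V : Set} {Y : FinGraph n} {Z : Graph (setoid V)} →
  Y ≅ Z → Bipartite Z → Bipartite Y
bipartite-≅ (f , iso) (colour , _ , proper) =
  colour ∘ Inverse.to f , cong (colour ∘ Inverse.to f) ,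
  λ {x} {y} xy → proper (Equivalence.to (iso x y) xy)

C₄-bipartite : Bipartite (C 4)
C₄-bipartite = colour , cong colour , λ {x} {y} → proper x y
  where
  colour : Fin 4 → Bool
  colour 0F = true
  colour 1F = false
  colour 2F = true
  colour 3F = false
  proper : ∀ x y → Graph._~_ (C 4) x y → colour x ≢ colour y
  -- Adjacency is decidable, so all pairs of vertices are checked by evaluation.
  proper = from-yes (all? λ x → all? λ y → Graph._~?_ (C 4) x y →-dec ¬? (colour x Bool.≟ colour y))

theorem1p3 : (n k : ℕ) → n ≥ 2 * k → 2 * k ≥ 4 → (Y : FinGraph n) →
    Disconnected Y ⊎ Bipartite Y ⊎ NonTrivialBridge k Y ⊎ (Y ≅ C n) →
    Disconnected (FS (K k (n ∸ k)) Y)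
theorem1p3 n 0 _ () Y
theorem1p3 n 1 _ (s≤s (s≤s ())) Y
-- With `k` in this form the number `k ∸ 2` of subdividing vertices reduces to `j`, and `zero` is a
-- token.
theorem1p3 n k@(suc (suc j)) n≥2k _ Y = λ where
    (inj₁ disconnected)           → disconnected ∘ connected⇒connected Y k+q≡n zero
    (inj₂ (inj₁ bipartite))       → bipartite⇒disconnected Y k+q≡n 2≤q bipartite
    (inj₂ (inj₂ (inj₁ bridge)))   → nonTrivialBridge⇒disconnected Y k+q≡n (fromℕ< 2≤q) bridge
    (inj₂ (inj₂ (inj₂ Y≅C)))      → cycle Y≅C (3 ℕ.≤? n ∸ k)
  where
  k≤q : k ≤ n ∸ k
  k≤q = ℕ.m+n≤o⇒m≤o∸n k (subst (λ l → k + l ≤ n) (ℕ.+-identityʳ k) n≥2k)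

  2≤q : 2 ≤ n ∸ k
  2≤q = ℕ.≤-trans (s≤s (s≤s z≤n)) k≤q

  k+q≡n : k + (n ∸ k) ≡ n
  k+q≡n = ℕ.m+[n∸m]≡n (ℕ.≤-trans (ℕ.m≤m+n k (k + 0)) n≥2k)

  cycle : Y ≅ C n → Dec (3 ≤ n ∸ k) → Disconnected (FS (K k (n ∸ k)) Y)
  cycle Y≅C (yes 3≤q) = cycle⇒disconnected Y k+q≡n 3≤q (Inverse.to (proj₁ Y≅C))
    (≅-injective {Y = Y} {Z = C n} Y≅C) (λ {x} {y} → Equivalence.to (proj₂ Y≅C x y))
  -- Here `2 ≤ k ≤ n ∸ k ≤ 2`, which forces `n` to be 4.
  cycle Y≅C (no q≱3) = bipartite⇒disconnected Y k+q≡n 2≤q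
    (bipartite-≅ {Y = Y} {Z = C n} Y≅C (subst (Bipartite ∘ C) (sym n≡4) C₄-bipartite))
    where
    q≡2 : n ∸ k ≡ 2
    q≡2 = ℕ.≤-antisym (s≤s⁻¹ (ℕ.≰⇒> q≱3)) 2≤q
    n≡4 : n ≡ 4
    n≡4 = trans (sym k+q≡n)
      (cong₂ _+_ (ℕ.≤-antisym (ℕ.≤-trans k≤q (ℕ.≤-reflexive q≡2)) (s≤s (s≤s z≤n))) q≡2)
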